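{- Let $\mathcal{V}$ be a variety of a plural type (possibly containing constant symbols), and let $\mathbf{A}$ be the P\l onka sum over a semilattice direct system $\mathbb{A}=(\{\mathbf{A}_i\}_{i\in I},(I,\le),\{p_{ij}\}_{i\le j})$ of algebras in $\mathcal{V}$. Then $\mathbf{A}$ is subdirectly irreducible if and only if one of the following holds: (1) $\mathbf{A}$ is a subdirectly irreducible member of $\mathcal{V}$; (2) there exists a subdirectly irreducible algebra $\mathbf{B}\in\mathcal{V}$ without absorbing elements such that $\mathbf{A}\cong\mathbf{B}^{\ast}$.
   Context: A type is plural if it contains at least one operation symbol of arity at least $2$. A semilattice direct system $\mathbb{A}=(\{\mathbf{A}_i\}_{i\in I},(I,\le),\{p_{ij}\}_{i\le j})$ consists of a join-semilattice $(I,\le)$ with join $\vee$ (required to have a least element $i_0$ when the type contains constants), a family of algebras $\mathbf{A}_i$ of the same type with pairwise disjoint universes, and homomorphisms $p_{ij}\colon\mathbf{A}_i\to\mathbf{A}_j$ for $i\le j$ with $p_{ii}=\mathrm{id}$ and $p_{ik}=p_{jk}\circ p_{ij}$ for $i\le j\le k$. Its P\l onka sum is the algebra with universe $\bigcup_{i\in I}A_i$ in which, for every $n$-ary operation $g$ with $n\ge1$ and $a_1\in A_{i_1},\dots,a_n\in A_{i_n}$, $g(a_1,\dots,a_n)=g^{\mathbf{A}_j}(p_{i_1j}(a_1),\dots,p_{i_nj}(a_n))$ with $j=i_1\vee\dots\vee i_n$, and every constant $c$ is interpreted as $c^{\mathbf{A}_{i_0}}$. For an algebra $\mathbf{B}$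 and $\infty\notin B$, $\mathbf{B}^{\ast}$ denotes the P\l onka sum over the system indexed by the two-element chain $i<j$, with $\mathbf{A}_i=\mathbf{B}$, $\mathbf{A}_j$ the trivial algebra with universe $\{\infty\}$, and $p_{ij}$ the unique map. An element $a$ of a non-trivial algebra $\mathbf{B}$ is absorbing if for every operation symbol $f$ of arity $n\ge1$, $a\in\{x_1,\dots,x_n\}$ implies $f^{\mathbf{B}}(x_1,\dots,x_n)=a$; by this definition trivial algebras have no absorbing elements. Convention: trivial algebras count as subdirectly irreducible. -}

module Defs where

open import Level using (Level; 0ℓ; _⊔_) renaming (suc to lsuc)
open import Data.Bool.Base using (Bool; true; false; _∨_; b≤b; f≤t) renaming (_≤_ to _≤ᵇ_)
open import Data.Bool.Properties using (≤-isPartialOrder; ≤-minimum)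
open import Data.Fin.Base using (Fin; zero; suc)
open import Data.Nat.Base using (ℕ; zero; suc; _≤_)
open import Data.Product.Base using (Σ; Σ-syntax; ∃; ∃-syntax; _×_; _,_; proj₁; proj₂)
open import Data.Sum.Base using (_⊎_)
open import Data.Unit.Polymorphic.Base using (⊤; tt)
open import Data.Vec.Functional using (Vector)
open import Function.Base using (_∘_; id)
open import Function.Definitions using (Injective; Surjective; Bijective)
open import Relation.Binary.Bundles using (Setoid)
open import Relation.Binary.Core using (Rel)
open import Relation.Binary.Definitions using (Minimum)
open import Relation.Binary.Lattice using (JoinSemilattice; Supremum)
open import Relation.Binary.PropositionalEquality.Core using (_≡_)
open import Relation.Nullary.Negation.Core using (¬_)

private variable
  ℓ : Level

-- A type of algebras: `τ n` is the set of n-ary operation symbols, so `τ 0`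
-- is the set of constant symbols.
Signature : (ℓ : Level) → Set (lsuc ℓ)
Signature ℓ = ℕ → Set ℓ

Plural : Signature ℓ → Set ℓ
Plural τ = ∃[ n ] (2 ≤ n × τ n)

-- Universes are setoids, so that A/θ is the carrier of A with θ as its equality.
-- As usual in universal algebra, universes are required to be nonempty.
record Algebra {s} (τ : Signature s) (ℓ : Level) : Set (s ⊔ lsuc ℓ) where
  field
    setoid   : Setoid ℓ ℓ
  open Setoid setoid public
  field
    nonEmpty : Carrier
    op       : ∀ {n} → τ n → Vector Carrier n → Carrier
    op-cong  : ∀ {n} (f : τ n) {x y : Vector Carrier n} →
               (∀ k → x k ≈ y k) → op f x ≈ op f y

record Hom {s ℓ₁ ℓ₂} {τ : Signature s}
           (𝐀 : Algebra τ ℓ₁) (𝐁 : Algebra τ ℓ₂) : Set (s ⊔ ℓ₁ ⊔ ℓ₂) where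
  private
    module A = Algebra 𝐀
    module B = Algebra 𝐁
  field
    to   : A.Carrier → B.Carrier
    cong : ∀ {x y} → x A.≈ y → to x B.≈ to y
    homo : ∀ {n} (f : τ n) (x : Vector A.Carrier n) →
           to (A.op f x) B.≈ B.op f (to ∘ x)

module _ {s ℓ₁ ℓ₂} {τ : Signature s}
         {𝐀 : Algebra τ ℓ₁} {𝐁 : Algebra τ ℓ₂} (h : Hom 𝐀 𝐁) where
  private
    module A = Algebra 𝐀
    module B = Algebra 𝐁

  IsEmbedding : Set (ℓ₁ ⊔ ℓ₂)
  IsEmbedding = Injective A._≈_ B._≈_ (Hom.to h)

  IsOnto : Set (ℓ₁ ⊔ ℓ₂)
  IsOnto = Surjective A._≈_ B._≈_ (Hom.to h)

  IsIsomorphism : Set (ℓ₁ ⊔ ℓ₂)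
  IsIsomorphism = Bijective A._≈_ B._≈_ (Hom.to h)

infixr 9 _∘ₕ_
infix 4 _≅_

idₕ : ∀ {s} {τ : Signature s} {𝐀 : Algebra τ ℓ} → Hom 𝐀 𝐀
idₕ {𝐀 = 𝐀} = record { to = id ; cong = id ; homo = λ _ _ → Algebra.refl 𝐀 }

_∘ₕ_ : ∀ {s ℓ₁ ℓ₂ ℓ₃} {τ : Signature s}
       {𝐀 : Algebra τ ℓ₁} {𝐁 : Algebra τ ℓ₂} {𝐂 : Algebra τ ℓ₃} →
       Hom 𝐁 𝐂 → Hom 𝐀 𝐁 → Hom 𝐀 𝐂
_∘ₕ_ {𝐂 = 𝐂} g h = record
  { to   = Hom.to g ∘ Hom.to h
  ; cong = Hom.cong g ∘ Hom.cong h
  ; homo = λ f x → Algebra.trans 𝐂 (Hom.cong g (Hom.homo h f x))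
                                   (Hom.homo g f (Hom.to h ∘ x))
  }

_≅_ : ∀ {s ℓ₁ ℓ₂} {τ : Signature s} → Algebra τ ℓ₁ → Algebra τ ℓ₂ → Set (s ⊔ ℓ₁ ⊔ ℓ₂)
𝐀 ≅ 𝐁 = Σ[ h ∈ Hom 𝐀 𝐁 ] IsIsomorphism h

module _ {s} {τ : Signature s} where

  ∏ : {J : Set ℓ} → (J → Algebra τ ℓ) → Algebra τ ℓ
  ∏ {J = J} 𝐂 = record
    { setoid = record
      { Carrier       = ∀ j → C.Carrier j
      ; _≈_           = λ x y → ∀ j → C._≈_ j (x j) (y j)
      ; isEquivalence = record
        { refl  = λ j → C.refl j
        ; sym   = λ p j → C.sym j (p j)
        ; trans = λ p q j → C.trans j (p j) (q j)
        }
      }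
    ; nonEmpty = λ j → C.nonEmpty j
    ; op       = λ f x j → C.op j f (λ k → x k j)
    ; op-cong  = λ f p j → C.op-cong j f (λ k → p k j)
    }
    where module C (j : J) = Algebra (𝐂 j)

  π : {J : Set ℓ} (𝐂 : J → Algebra τ ℓ) (j : J) → Hom (∏ 𝐂) (𝐂 j)
  π 𝐂 j = record
    { to   = λ x → x j
    ; cong = λ p → p j
    ; homo = λ _ _ → Algebra.refl (𝐂 j)
    }

  Trivial : Algebra τ ℓ → Set ℓ
  Trivial 𝐀 = ∀ x y → x ≈ y
    where open Algebra 𝐀

  IsSubdirectEmbedding : {𝐀 : Algebra τ ℓ} {J : Set ℓ} (𝐂 : J → Algebra τ ℓ) →
                         Hom 𝐀 (∏ 𝐂) → Set ℓ
  IsSubdirectEmbedding 𝐂 α = IsEmbedding α × (∀ j → IsOnto (π 𝐂 j ∘ₕ α))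

  -- The index set J may be empty; since the only algebras embeddable in the
  -- empty product are trivial, the second disjunct concerns non-trivial algebras.
  SubdirectlyIrreducible : Algebra τ ℓ → Set (s ⊔ lsuc ℓ)
  SubdirectlyIrreducible {ℓ = ℓ} 𝐀 =
    Trivial 𝐀 ⊎
    (∀ {J : Set ℓ} (𝐂 : J → Algebra τ ℓ) (α : Hom 𝐀 (∏ 𝐂)) →
     IsSubdirectEmbedding 𝐂 α → ∃[ j ] IsIsomorphism (π 𝐂 j ∘ₕ α))

  Absorbing : (𝐁 : Algebra τ ℓ) → Algebra.Carrier 𝐁 → Set (s ⊔ ℓ)
  Absorbing 𝐁 a =
    ¬ Trivial 𝐁 ×
    (∀ {n} (f : τ (suc n)) (x : Vector Carrier (suc n)) →
     (∃[ k ] a ≈ x k) → op f x ≈ a)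
    where open Algebra 𝐁

  HasAbsorbing : Algebra τ ℓ → Set (s ⊔ ℓ)
  HasAbsorbing 𝐁 = ∃[ a ] Absorbing 𝐁 a

-- Closure under isomorphic copies is part of `closed-H`.
record Variety {s} (τ : Signature s) (ℓ v : Level) : Set (s ⊔ lsuc ℓ ⊔ lsuc v) where
  field
    Member   : Algebra τ ℓ → Set v
    closed-H : ∀ {𝐀 𝐁} (h : Hom 𝐀 𝐁) → IsOnto h → Member 𝐀 → Member 𝐁
    closed-S : ∀ {𝐀 𝐁} (h : Hom 𝐀 𝐁) → IsEmbedding h → Member 𝐁 → Member 𝐀
    closed-P : {J : Set ℓ} (𝐂 : J → Algebra τ ℓ) → (∀ j → Member (𝐂 j)) → Member (∏ 𝐂)

infix 4 _∈ᵥ_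

_∈ᵥ_ : ∀ {s v} {τ : Signature s} → Algebra τ ℓ → Variety τ ℓ v → Set v
𝐀 ∈ᵥ 𝒱 = Variety.Member 𝒱 𝐀

-- The coherence laws hold for all proofs of the order relations involved, hence
-- p does not depend on the proof of i ≤ j, and p is invertible when i ≈ j.
-- `least` is vacuous without constants; least elements are unique up to ≈.
record SemilatticeSystem {s} (τ : Signature s) (ι ℓ : Level) :
                         Set (s ⊔ lsuc ι ⊔ lsuc ℓ) where
  field
    index : JoinSemilattice ι ι ι
  module I = JoinSemilattice index
  field
    index-nonEmpty : I.Carrier
    least          : τ 0 → ∃[ i₀ ] Minimum I._≤_ i₀
    fibre          : I.Carrier → Algebra τ ℓ
    p              : ∀ {i j} → i I.≤ j → Hom (fibre i) (fibre j)
    p-id           : ∀ {i} (q : i I.≤ i) x → Algebra._≈_ (fibre i) (Hom.to (p q) x) x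
    p-comp         : ∀ {i j k} (q : i I.≤ j) (r : j I.≤ k) (t : i I.≤ k) x →
                     Algebra._≈_ (fibre k) (Hom.to (p t) x) (Hom.to (p r) (Hom.to (p q) x))

module _ {ι} (𝐈 : JoinSemilattice ι ι ι) where
  private module I = JoinSemilattice 𝐈

  ⋁ : ∀ {n} → Vector I.Carrier (suc n) → I.Carrier
  ⋁ {zero}  i = i zero
  ⋁ {suc n} i = i zero I.∨ ⋁ (i ∘ suc)

  ≤-⋁ : ∀ {n} (i : Vector I.Carrier (suc n)) k → i k I.≤ ⋁ i
  ≤-⋁ {zero}  i zero    = I.refl
  ≤-⋁ {suc n} i zero    = I.x≤x∨y _ _
  ≤-⋁ {suc n} i (suc k) = I.trans (≤-⋁ (i ∘ suc) k) (I.y≤x∨y _ _)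

  ⋁-least : ∀ {n} (i : Vector I.Carrier (suc n)) {j} → (∀ k → i k I.≤ j) → ⋁ i I.≤ j
  ⋁-least {zero}  i q = q zero
  ⋁-least {suc n} i q = I.∨-least (q zero) (⋁-least (i ∘ suc) (q ∘ suc))

-- The disjoint union of the universes is a Σ-type, so the universes need not be
-- assumed disjoint. Elements of 𝐀ᵢ and 𝐀ⱼ are equal when i ≈ j and they
-- correspond under pᵢⱼ; for i = j this is equality in 𝐀ᵢ.
module _ {s ι ℓ} {τ : Signature s} (𝔸 : SemilatticeSystem τ ι ℓ) where
  private
    open SemilatticeSystem 𝔸
    module A (i : I.Carrier) = Algebra (fibre i)

    Universe : Set (ι ⊔ ℓ)
    Universe = Σ I.Carrier A.Carrier

    _~_ : Rel Universe (ι ⊔ ℓ)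
    (i , a) ~ (j , b) = Σ[ e ∈ i I.≈ j ] A._≈_ j (Hom.to (p (I.reflexive e)) a) b

    ~-refl : ∀ {x} → x ~ x
    ~-refl = I.Eq.refl , p-id _ _

    ~-sym : ∀ {x y} → x ~ y → y ~ x
    ~-sym {i , a} {j , b} (e , q) = I.Eq.sym e ,
      A.trans i (Hom.cong (p _) (A.sym j q))
        (A.trans i (A.sym i (p-comp _ _ I.refl a)) (p-id _ a))

    ~-trans : ∀ {x y z} → x ~ y → y ~ z → x ~ z
    ~-trans {i , a} {j , b} {k , c} (e , q) (e′ , q′) = I.Eq.trans e e′ ,
      A.trans k (p-comp _ _ _ a) (A.trans k (Hom.cong (p _) q) q′)

    opᴾ : ∀ {n} → τ n → Vector Universe n → Universe
    opᴾ {zero}  c x = proj₁ (least c) , A.op (proj₁ (least c)) c (λ ())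
    opᴾ {suc n} g x = j , A.op j g (λ k → Hom.to (p (≤-⋁ index i k)) (proj₂ (x k)))
      where
      i = proj₁ ∘ x
      j = ⋁ index i

    opᴾ-cong : ∀ {n} (g : τ n) {x y : Vector Universe n} →
               (∀ k → x k ~ y k) → opᴾ g x ~ opᴾ g y
    opᴾ-cong {zero}  c e = ~-refl
    opᴾ-cong {suc n} g {x} {y} e =
      I.antisym
        (⋁-least index _ λ k → I.trans (I.reflexive (proj₁ (e k))) (≤-⋁ index (proj₁ ∘ y) k))
        (⋁-least index _ λ k → I.trans (I.reflexive (I.Eq.sym (proj₁ (e k)))) (≤-⋁ index (proj₁ ∘ x) k)) ,
      A.trans j (Hom.homo (p _) g _) (A.op-cong j g λ k →
        A.trans j (A.sym j (p-comp (≤-⋁ index (proj₁ ∘ x) k) _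
                      (I.trans (I.reflexive (proj₁ (e k))) (≤-⋁ index (proj₁ ∘ y) k)) _))
          (A.trans j (p-comp (I.reflexive (proj₁ (e k))) (≤-⋁ index (proj₁ ∘ y) k) _ _)
            (Hom.cong (p _) (proj₂ (e k)))))
      where j = ⋁ index (proj₁ ∘ y)

  PłonkaSum : Algebra τ (ι ⊔ ℓ)
  PłonkaSum = record
    { setoid   = record
      { Carrier       = Universe
      ; _≈_           = _~_
      ; isEquivalence = record
        { refl  = λ {x} → ~-refl {x}
        ; sym   = λ {x y} → ~-sym {x} {y}
        ; trans = λ {x y z} → ~-trans {x} {y} {z}
        }
      }
    ; nonEmpty = index-nonEmpty , A.nonEmpty index-nonEmpty
    ; op       = opᴾ
    ; op-cong  = opᴾ-cong
    }

twoChain : JoinSemilattice 0ℓ 0ℓ 0ℓ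
twoChain = record
  { Carrier           = Bool
  ; _≈_               = _≡_
  ; _≤_               = _≤ᵇ_
  ; _∨_               = _∨_
  ; isJoinSemilattice = record
    { isPartialOrder = ≤-isPartialOrder
    ; supremum       = supremum
    }
  }
  where
  supremum : Supremum _≤ᵇ_ _∨_
  supremum false y = ≤-minimum y , b≤b , λ _ _ q → q
  supremum true  false = b≤b , f≤t , λ _ q _ → q
  supremum true  true  = b≤b , b≤b , λ _ q _ → q

module _ {s} {τ : Signature s} where

  trivialAlgebra : Algebra τ ℓ
  trivialAlgebra = record
    { setoid   = record { Carrier = ⊤ ; _≈_ = λ _ _ → ⊤ }
    ; nonEmpty = tt
    ; op       = λ _ _ → tt
    ; op-cong  = λ _ _ → tt
    }

  toTrivial : {𝐁 : Algebra τ ℓ} → Hom 𝐁 (trivialAlgebra {ℓ = ℓ})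
  toTrivial = record { to = λ _ → tt ; cong = λ _ → tt ; homo = λ _ _ → tt }

  -- The fibre over false (the least index) is 𝐁, the fibre over true is {∞}.
  starSystem : Algebra τ ℓ → SemilatticeSystem τ 0ℓ ℓ
  starSystem {ℓ = ℓ} 𝐁 = record
    { index          = twoChain
    ; index-nonEmpty = false
    ; least          = λ _ → false , ≤-minimum
    ; fibre          = fibre
    ; p              = p
    ; p-id           = p-id
    ; p-comp         = p-comp
    }
    where
    fibre : Bool → Algebra τ ℓ
    fibre false = 𝐁
    fibre true  = trivialAlgebra

    p : ∀ {i j} → i ≤ᵇ j → Hom (fibre i) (fibre j)
    p b≤b = idₕ
    p f≤t = toTrivial

    p-id : ∀ {i} (q : i ≤ᵇ i) x → Algebra._≈_ (fibre i) (Hom.to (p q) x) x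
    p-id {i} b≤b x = Algebra.refl (fibre i)

    p-comp : ∀ {i j k} (q : i ≤ᵇ j) (r : j ≤ᵇ k) (t : i ≤ᵇ k) x →
             Algebra._≈_ (fibre k) (Hom.to (p t) x) (Hom.to (p r) (Hom.to (p q) x))
    p-comp {k = true}          q   r   t   x = tt
    p-comp {k = false} b≤b b≤b b≤b x = Algebra.refl 𝐁

  infix 25 _*

  _* : Algebra τ ℓ → Algebra τ ℓ
  𝐁 * = PłonkaSum (starSystem 𝐁)

{-# OPTIONS --safe #-}

-- Subdirect irreducibility of a non-trivial algebra 𝐀 says that every jointly
-- injective family of homomorphisms out of 𝐀 has an injective member (factor
-- through the kernels).  For every index i there is a homomorphism from the
-- Płonka sum to 𝐀ᵢ*, acting as pⱼᵢ on 𝐀ⱼ when j ≤ i and sending 𝐀ⱼ to ∞ otherwise;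
-- these are jointly injective, so if the sum is irreducible then one of them
-- embeds it in 𝐀ᵢ*, which makes it isomorphic to 𝐀ᵢ or to 𝐀ᵢ*.
--
-- Irreducibility of 𝐁* passes to 𝐁 because ( )* is functorial, and it excludes an
-- absorbing element a because the retraction 𝐁* → 𝐁, ∞ ↦ a, and the map from 𝐁*
-- to the star of the trivial algebra are jointly injective.  Conversely, if a
-- homomorphism out of 𝐁* is injective on 𝐁 but sends b and ∞ to the same element,
-- then b is absorbing.
module Submission where

open import Defs
open import Level using (Level; Lift; lift)
open import Axiom.ExcludedMiddle using (ExcludedMiddle)
open import Data.Bool.Base using (Bool; true; false; b≤b) renaming (_≤_ to _≤ᵇ_)
open import Data.Bool.Properties using (_≟_; ¬-not; ≤-minimum)
open import Data.Empty using (⊥-elim)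
open import Data.Fin.Base using (zero)
import Data.Fin.Properties as Fin
open import Data.Fin.Properties using (any?; ¬∀⟶∃¬)
open import Data.Nat.Base using (zero; suc)
open import Data.Product.Base using (_×_; _,_; ∃-syntax; proj₁; proj₂)
open import Data.Sum.Base using (_⊎_; inj₁; inj₂)
open import Data.Unit.Polymorphic.Base using (tt)
open import Data.Vec.Functional using (Vector; updateAt)
open import Data.Vec.Functional.Properties using (updateAt-updates; updateAt-minimal)
open import Function.Base using (_∘_)
open import Function.Bundles using (_⇔_; mk⇔)
open import Relation.Binary.Definitions using (Minimum)
open import Relation.Binary.PropositionalEquality using (_≡_; refl)
import Relation.Binary.PropositionalEquality as ≡
import Relation.Binary.Reasoning.Setoid as SetoidReasoning
open import Relation.Nullary.Decidable.Core using (Dec; yes; no; decidable-stable)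
open import Relation.Nullary.Negation.Core using (¬_; contradiction)

private variable
  s ℓ ℓ₁ ℓ₂ : Level
  τ : Signature s

-- Isomorphisms, and irreducibility in terms of jointly injective families.

≅-sym : {𝐀 : Algebra τ ℓ₁} {𝐁 : Algebra τ ℓ₂} → 𝐀 ≅ 𝐁 → 𝐁 ≅ 𝐀
≅-sym {𝐀 = 𝐀} {𝐁 = 𝐁} (f , inj , surj) = g , g-inj , g-surj
  where
  module A = Algebra 𝐀
  module B = Algebra 𝐁
  module F = Hom f

  from : B.Carrier → A.Carrier
  from y = proj₁ (surj y)

  to-from : ∀ y → F.to (from y) B.≈ y
  to-from y = proj₂ (surj y) A.refl

  g : Hom 𝐁 𝐀
  g = record
    { to   = from
    ; cong = λ {x} {y} q → inj (B.trans (to-from x) (B.trans q (B.sym (to-from y))))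
    ; homo = λ φ x → inj (B.trans (to-from _)
        (B.sym (B.trans (F.homo φ _) (B.op-cong φ (to-from ∘ x)))))
    }

  g-inj : IsEmbedding g
  g-inj {x} {y} q = B.trans (B.sym (to-from x)) (B.trans (F.cong q) (to-from y))

  g-surj : IsOnto g
  g-surj x = F.to x , λ q → inj (B.trans (to-from _) q)

JointlyInjective : {𝐀 : Algebra τ ℓ} {J : Set ℓ} (𝐂 : J → Algebra τ ℓ) →
                   (∀ j → Hom 𝐀 (𝐂 j)) → Set ℓ
JointlyInjective {𝐀 = 𝐀} 𝐂 h = ∀ x y →
  (∀ j → Algebra._≈_ (𝐂 j) (Hom.to (h j) x) (Hom.to (h j) y)) → Algebra._≈_ 𝐀 x y

-- The members of the family need not be onto. Taking `J` empty shows that this property excludes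
-- trivial algebras.
Irreducible : Algebra {s} τ ℓ → Set _
Irreducible {τ = τ} {ℓ = ℓ} 𝐀 = ∀ {J : Set ℓ} (𝐂 : J → Algebra τ ℓ) (h : ∀ j → Hom 𝐀 (𝐂 j)) →
  JointlyInjective 𝐂 h → ∃[ j ] IsEmbedding (h j)

-- A copy of the image of `h`: keeping the carrier of `𝐀` and coarsening its equality makes the
-- quotient map the identity on elements, hence onto.
_/ker_ : (𝐀 : Algebra τ ℓ) {𝐂 : Algebra τ ℓ} → Hom 𝐀 𝐂 → Algebra τ ℓ
_/ker_ 𝐀 {𝐂} h = record
  { setoid = record
    { Carrier       = A.Carrier
    ; _≈_           = λ x y → H.to x C.≈ H.to y
    ; isEquivalence = record { refl = C.refl ; sym = C.sym ; trans = C.trans }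
    }
  ; nonEmpty = A.nonEmpty
  ; op       = A.op
  ; op-cong  = λ f q → C.trans (H.homo f _) (C.trans (C.op-cong f q) (C.sym (H.homo f _)))
  }
  where
  module A = Algebra 𝐀
  module C = Algebra 𝐂
  module H = Hom h

irreducible⇒SI : {𝐀 : Algebra τ ℓ} → Irreducible 𝐀 → SubdirectlyIrreducible 𝐀
irreducible⇒SI irr = inj₂ λ 𝐂 α (emb , onto) →
  let j , inj = irr 𝐂 (λ j → π 𝐂 j ∘ₕ α) (λ x y → emb) in j , inj , onto j

SI⇒trivial⊎irreducible : {𝐀 : Algebra τ ℓ} → SubdirectlyIrreducible 𝐀 → Trivial 𝐀 ⊎ Irreducible 𝐀
SI⇒trivial⊎irreducible (inj₁ t) = inj₁ t
SI⇒trivial⊎irreducible {𝐀 = 𝐀} (inj₂ si) = inj₂ λ 𝐂 h inj →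
  let quotients = λ j → 𝐀 /ker h j
      α : Hom 𝐀 (∏ quotients)
      α = record
        { to   = λ x _ → x
        ; cong = λ q j → Hom.cong (h j) q
        ; homo = λ f x j → Algebra.refl (𝐂 j)
        }
      -- Equality in the `j`-th quotient is the kernel of `h j`, so an injective projection onto it
      -- says that `h j` itself is injective.
      j , emb , _ = si quotients α ((λ {x} {y} → inj x y) , λ j y → y , Hom.cong (h j))
  in j , emb

irreducible-resp-≅ : {𝐀 𝐁 : Algebra τ ℓ} → 𝐀 ≅ 𝐁 → Irreducible 𝐀 → Irreducible 𝐁
irreducible-resp-≅ {𝐀 = 𝐀} {𝐁 = 𝐁} (f , inj , surj) irr 𝐂 h h-inj =
  j , λ {u} {v} q →
    let module C = Algebra (𝐂 j)
        x , fx = surj u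
        y , fy = surj v
        fx≈u = fx A.refl
        fy≈v = fy A.refl
    in B.trans (B.sym fx≈u) (B.trans (Hom.cong f (emb
         (C.trans (Hom.cong (h j) fx≈u) (C.trans q (C.sym (Hom.cong (h j) fy≈v)))))) fy≈v)
  where
  module A = Algebra 𝐀
  module B = Algebra 𝐁
  member = irr 𝐂 (λ j → h j ∘ₕ f) (λ x y q → inj (h-inj _ _ q))
  j = proj₁ member
  emb = proj₂ member

irreducible₂ : {𝐀 𝐂 𝐃 : Algebra τ ℓ} → Irreducible 𝐀 → (g : Hom 𝐀 𝐂) (h : Hom 𝐀 𝐃) →
               (∀ x y → Algebra._≈_ 𝐂 (Hom.to g x) (Hom.to g y) →
                        Algebra._≈_ 𝐃 (Hom.to h x) (Hom.to h y) → Algebra._≈_ 𝐀 x y) →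
               IsEmbedding g ⊎ IsEmbedding h
irreducible₂ {τ = τ} {ℓ = ℓ} {𝐀 = 𝐀} {𝐂} {𝐃} irr g h inj =
  case (irr family homs λ x y q → inj x y (q (lift false)) (q (lift true)))
  where
  family : Lift ℓ Bool → Algebra τ ℓ
  family (lift false) = 𝐂
  family (lift true)  = 𝐃

  homs : ∀ j → Hom 𝐀 (family j)
  homs (lift false) = g
  homs (lift true)  = h

  case : ∃[ j ] IsEmbedding (homs j) → IsEmbedding g ⊎ IsEmbedding h
  case (lift false , emb) = inj₁ emb
  case (lift true  , emb) = inj₂ emb

-- Fibres inside a Płonka sum.

module _ {ι : Level} (𝔸 : SemilatticeSystem {s} τ ι ℓ) where
  open SemilatticeSystem 𝔸
  private module A (i : I.Carrier) = Algebra (fibre i)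

  p-irrelevant : ∀ {i j} (q r : i I.≤ j) x → A._≈_ j (Hom.to (p q) x) (Hom.to (p r) x)
  p-irrelevant {j = j} q r x =
    A.trans j (p-comp r I.refl q x) (p-id I.refl _)

  -- Constants of the sum live over the least index, so when there are any, only a fibre over a
  -- least index is a subalgebra. For the other operations, a join of copies of `i` is again `i`.
  fibreInclusion : ∀ i → (τ 0 → Minimum I._≤_ i) → Hom (fibre i) (PłonkaSum 𝔸)
  fibreInclusion i min = record
    { to   = i ,_
    ; cong = λ q → I.Eq.refl , A.trans i (p-id _ _) q
    ; homo = homo
    }
    where
    homo : ∀ {n} (f : τ n) (x : Vector (A.Carrier i) n) →
           Algebra._≈_ (PłonkaSum 𝔸) (i , A.op i f x) (Algebra.op (PłonkaSum 𝔸) f (λ k → i , x k))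
    homo {zero} c x =
      I.antisym (min c _) (proj₂ (least c) i) ,
      A.trans _ (Hom.homo (p _) c x) (A.op-cong _ c λ ())
    homo {suc n} f x =
      I.antisym (≤-⋁ index {n} (λ _ → i) zero) (⋁-least index {n} (λ _ → i) λ _ → I.refl) ,
      A.trans _ (Hom.homo (p _) f x) (A.op-cong _ f λ k → p-irrelevant _ _ (x k))

-- The algebra `𝐁 *` and homomorphisms out of it.

Absorbs : (𝐂 : Algebra {s} τ ℓ) → Algebra.Carrier 𝐂 → Set _
Absorbs {τ = τ} 𝐂 c = ∀ {n} (f : τ (suc n)) (x : Vector Carrier (suc n)) →
  (∃[ k ] c ≈ x k) → op f x ≈ c
  where open Algebra 𝐂

module Star {s ℓ : Level} {τ : Signature s} (𝐁 : Algebra τ ℓ) where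
  open Algebra (𝐁 *) public hiding (refl)
  private module B = Algebra 𝐁

  ∞ : Carrier
  ∞ = true , tt

  inclusion : Hom 𝐁 (𝐁 *)
  inclusion = fibreInclusion (starSystem 𝐁) false (λ _ → ≤-minimum)

  inclusion-injective : IsEmbedding inclusion
  inclusion-injective (refl , q) = q

  finite≉∞ : ∀ b → ¬ ((false , b) ≈ ∞)
  finite≉∞ _ (() , _)

  -- Constructive, since there are finitely many arguments and their indices are Booleans.
  finite⊎∞ : ∀ {n} (x : Vector Carrier n) →
             (∃[ b ] (∀ k → x k ≈ (false , b k))) ⊎ (∃[ k ] ∞ ≈ x k)
  finite⊎∞ x with any? (λ k → proj₁ (x k) ≟ true)
  ... | yes (k , e) = inj₂ (k , ∞≈ (x k) e)
    where
    ∞≈ : ∀ y → proj₁ y ≡ true → ∞ ≈ y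
    ∞≈ (true , _) refl = refl , tt
  ... | no none = inj₁ ((λ k → proj₁ (finite (x k) (¬-not λ e → none (k , e)))) ,
                         λ k → proj₂ (finite (x k) (¬-not λ e → none (k , e))))
    where
    finite : ∀ y → proj₁ y ≡ false → ∃[ b ] y ≈ (false , b)
    finite (false , b) refl = b , refl , B.refl

  ∞-absorbs : Absorbs (𝐁 *) ∞
  ∞-absorbs f x (k , e , _) = top (≤-⋁ twoChain (proj₁ ∘ x) k) e , tt
    where
    top : ∀ {i j} → i ≤ᵇ j → true ≡ i → j ≡ true
    top b≤b refl = refl

  -- If some argument is `∞`, absorption gives `∞` before and `c` after the map; otherwise the
  -- operation is computed in `𝐁`. This yields both the functoriality of the star and the retraction
  -- onto an algebra with an absorbing element.
  extend : ∀ {ℓ′} {𝐂 : Algebra τ ℓ′} (g : Hom 𝐁 𝐂) (c : Algebra.Carrier 𝐂) → Absorbs 𝐂 c →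
           Hom (𝐁 *) 𝐂
  extend {𝐂 = 𝐂} g c abs = record { to = to ; cong = λ {x} {y} → cong x y ; homo = homo }
    where
    module C = Algebra 𝐂
    module G = Hom g

    to : Carrier → C.Carrier
    to (false , b) = G.to b
    to (true  , _) = c

    cong : ∀ x y → x ≈ y → to x C.≈ to y
    cong (false , _) (false , _) (refl , q) = G.cong q
    cong (true  , _) (true  , _) _          = C.refl

    homo : ∀ {n} (f : τ n) (x : Vector Carrier n) → to (op f x) C.≈ C.op f (to ∘ x)
    homo {zero}  f x = C.trans (G.homo f _) (C.op-cong f λ ())
    homo {suc n} f x with finite⊎∞ x
    ... | inj₁ (b , q) = begin
      to (op f x)                      ≈⟨ cong _ _ (op-cong f q) ⟩
      to (op f (λ k → false , b k))    ≈⟨ cong (false , B.op f b) (op f (λ k → false , b k))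
                                            (Hom.homo inclusion f b) ⟨
      G.to (B.op f b)                  ≈⟨ G.homo f b ⟩
      C.op f (G.to ∘ b)                ≈⟨ C.op-cong f (λ k → cong _ _ (q k)) ⟨
      C.op f (to ∘ x)                  ∎
      where open SetoidReasoning C.setoid
    ... | inj₂ (k , q) =
      C.trans (cong _ _ (∞-absorbs f x (k , q))) (C.sym (abs f (to ∘ x) (k , cong _ _ q)))

  embedding : ∀ {ℓ′} {𝐂 : Algebra τ ℓ′} (h : Hom (𝐁 *) 𝐂) → IsEmbedding (h ∘ₕ inclusion) →
              (∀ b → ¬ Algebra._≈_ 𝐂 (Hom.to h (false , b)) (Hom.to h ∞)) → IsEmbedding h
  embedding h inj sep {false , a} {false , b} q = Hom.cong inclusion (inj q)
  embedding h inj sep {false , a} {true  , _} q = contradiction q (sep a)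
  embedding {𝐂 = 𝐂} h inj sep {true  , _} {false , b} q = contradiction (Algebra.sym 𝐂 q) (sep b)
  embedding h inj sep {true  , _} {true  , _} q = refl , tt

  -- Replacing the argument `b` by `∞` does not change the value under `h`, but turns the result
  -- into `∞`, whose image is that of `b`; injectivity on `𝐁` then gives the claim.
  merged⇒absorbs : ∀ {ℓ′} {𝐂 : Algebra τ ℓ′} (h : Hom (𝐁 *) 𝐂) → IsEmbedding (h ∘ₕ inclusion) →
                   ∀ {b} → Algebra._≈_ 𝐂 (Hom.to h (false , b)) (Hom.to h ∞) → Absorbs 𝐁 b
  merged⇒absorbs {𝐂 = 𝐂} h inj {b} q f x (k , b≈xk) = inj (begin
    H.to (false , B.op f x)        ≈⟨ Hom.homo (h ∘ₕ inclusion) f x ⟩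
    C.op f (H.to ∘ (false ,_) ∘ x) ≈⟨ C.op-cong f agree ⟩
    C.op f (H.to ∘ y)              ≈⟨ H.homo f y ⟨
    H.to (op f y)                  ≈⟨ H.cong {op f y} {∞} (∞-absorbs f y (k , reflexive (≡.sym yk≡∞))) ⟩
    H.to ∞                         ≈⟨ q ⟨
    H.to (false , b)               ∎)
    where
    module C = Algebra 𝐂
    module H = Hom h
    open SetoidReasoning C.setoid

    y : Vector Carrier _
    y = updateAt ((false ,_) ∘ x) k (λ _ → ∞)

    yk≡∞ : y k ≡ ∞
    yk≡∞ = updateAt-updates k ((false ,_) ∘ x)

    agree : ∀ l → H.to (false , x l) C.≈ H.to (y l)
    agree l with l Fin.≟ k
    ... | no l≢k = C.reflexive (≡.cong H.to (≡.sym (updateAt-minimal l k _ l≢k)))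
    ... | yes refl = begin
      H.to (false , x k) ≈⟨ Hom.cong (h ∘ₕ inclusion) b≈xk ⟨
      H.to (false , b)   ≈⟨ q ⟩
      H.to ∞             ≡⟨ ≡.cong H.to yk≡∞ ⟨
      H.to (y k)         ∎

_*ₕ : {𝐁 𝐂 : Algebra τ ℓ} → Hom 𝐁 𝐂 → Hom (𝐁 *) (𝐂 *)
_*ₕ {𝐁 = 𝐁} {𝐂} g = Star.extend 𝐁 (Star.inclusion 𝐂 ∘ₕ g) (Star.∞ 𝐂) (Star.∞-absorbs 𝐂)

-- Irreducibility of `𝐁 *` compared with that of `𝐁`.

*-no-absorbing : (𝐁 : Algebra τ ℓ) → Irreducible (𝐁 *) → ¬ HasAbsorbing 𝐁
*-no-absorbing 𝐁 irr (a , nontrivial , abs)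
  with irreducible₂ irr (Star.extend 𝐁 idₕ a abs) (toTrivial {𝐁 = 𝐁} *ₕ) separate
  where
  separate : ∀ x y → _
  separate (false , _) (false , _) q _ = Hom.cong (Star.inclusion 𝐁) q
  separate (false , _) (true  , _) _ (() , _)
  separate (true  , _) (false , _) _ (() , _)
  separate (true  , _) (true  , _) _ _ = refl , tt
-- The retraction identifies `a` with `∞`.
... | inj₁ emb = Star.finite≉∞ 𝐁 a (emb {false , a} {Star.∞ 𝐁} (Algebra.refl 𝐁))
-- The second map collapses all of `𝐁` to one point, so its injectivity would make `𝐁` trivial.
... | inj₂ emb = nontrivial λ x y →
  Star.inclusion-injective 𝐁 (emb {false , x} {false , y} (refl , tt))

module Classical {ℓ : Level} (em : ExcludedMiddle ℓ) {τ : Signature ℓ} where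

  *-irreducible⇒SI : (𝐁 : Algebra τ ℓ) → Irreducible (𝐁 *) → SubdirectlyIrreducible 𝐁
  *-irreducible⇒SI 𝐁 irr with em {Trivial 𝐁}
  ... | yes t = inj₁ t
  ... | no nontrivial = irreducible⇒SI irreducible
    where
    irreducible : Irreducible 𝐁
    -- An empty family is jointly injective only on a trivial algebra. When there is an index `j₀`,
    -- the starred map at `j₀` already separates finite elements from `∞`.
    irreducible {J} 𝐂 h inj with em {J}
    ... | no empty = contradiction (λ x y → inj x y (⊥-elim ∘ empty)) nontrivial
    ... | yes j₀ = j , λ q → Star.inclusion-injective 𝐁 (emb (Hom.cong (Star.inclusion (𝐂 j)) q))
      where
      inj* : JointlyInjective (λ j → 𝐂 j *) (λ j → h j *ₕ)
      inj* (false , a) (false , b) q =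
        Hom.cong (Star.inclusion 𝐁) (inj a b λ j → Star.inclusion-injective (𝐂 j) (q j))
      inj* (false , _) (true  , _) q with () ← proj₁ (q j₀)
      inj* (true  , _) (false , _) q with () ← proj₁ (q j₀)
      inj* (true  , _) (true  , _) q = refl , tt

      member = irr (λ j → 𝐂 j *) (λ j → h j *ₕ) inj*
      j = proj₁ member
      emb = proj₂ member

  *-irreducible : (𝐁 : Algebra τ ℓ) → SubdirectlyIrreducible 𝐁 → ¬ HasAbsorbing 𝐁 →
                  Irreducible (𝐁 *)
  *-irreducible 𝐁 si no-absorbing 𝐂 h inj with em {Trivial 𝐁}
  -- Here `𝐁 *` has just two elements up to equality, so a map separating them is an embedding, and
  -- joint injectivity provides one.
  ... | yes t with em {∃[ j ] ¬ Algebra._≈_ (𝐂 j) (Hom.to (h j) (false , Algebra.nonEmpty 𝐁))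
                                                  (Hom.to (h j) (Star.∞ 𝐁))}
  ...   | yes (j , sep) = j , Star.embedding 𝐁 (h j) (λ _ → t _ _) λ b q → sep
    (Algebra.trans (𝐂 j) (Hom.cong (h j) (Hom.cong (Star.inclusion 𝐁) (t _ b))) q)
  ...   | no none = ⊥-elim (Star.finite≉∞ 𝐁 (Algebra.nonEmpty 𝐁)
    (inj (false , Algebra.nonEmpty 𝐁) (Star.∞ 𝐁) λ j →
      decidable-stable em λ sep → none (j , sep)))
  *-irreducible 𝐁 si no-absorbing 𝐂 h inj | no nontrivial with SI⇒trivial⊎irreducible si
  ... | inj₁ t = contradiction t nontrivial
  ... | inj₂ irr =
    let j , emb = irr 𝐂 (λ j → h j ∘ₕ Star.inclusion 𝐁)
                    (λ x y q → Star.inclusion-injective 𝐁 (inj (false , x) (false , y) q))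
    in j , Star.embedding 𝐁 (h j) emb
         λ b q → no-absorbing (b , nontrivial , Star.merged⇒absorbs 𝐁 (h j) emb q)

  -- The homomorphisms from a Płonka sum to the stars of its fibres.

  module _ (𝔸 : SemilatticeSystem τ ℓ ℓ) where
    open SemilatticeSystem 𝔸
    private
      𝐀 = PłonkaSum 𝔸
      module A = Algebra 𝐀
      module Fib (i : I.Carrier) = Algebra (fibre i)
      module S (i : I.Carrier) = Star (fibre i)

    module ToStar (i : I.Carrier) where

      -- With the decision as an argument, a later `with em` makes `to` compute.
      toBelow : ∀ {j} → Dec (j I.≤ i) → Fib.Carrier j → S.Carrier i
      toBelow (yes q) a = false , Hom.to (p q) a
      toBelow (no _)  _ = S.∞ i

      to : A.Carrier → S.Carrier i
      to (j , a) = toBelow em a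

      below : ∀ {j} (q : j I.≤ i) a → S._≈_ i (to (j , a)) (false , Hom.to (p q) a)
      below {j} q a with em {j I.≤ i}
      ... | yes r = refl , p-irrelevant 𝔸 r q a
      ... | no ¬q = contradiction q ¬q

      notBelow : ∀ {j} → ¬ j I.≤ i → ∀ a → S._≈_ i (to (j , a)) (S.∞ i)
      notBelow {j} ¬q a with em {j I.≤ i}
      ... | yes q = contradiction q ¬q
      ... | no _  = refl , tt

      ≈∞⇒notBelow : ∀ {j} a → S._≈_ i (to (j , a)) (S.∞ i) → ¬ j I.≤ i
      ≈∞⇒notBelow {j} a e q =
        S.finite≉∞ i (Hom.to (p q) a) (begin
          (false , Hom.to (p q) a) ≈⟨ below q a ⟨
          to (j , a)               ≈⟨ e ⟩
          S.∞ i                    ∎)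
        where open SetoidReasoning (S.setoid i)

      cong : ∀ {x y} → x A.≈ y → S._≈_ i (to x) (to y)
      cong {j , a} {k , b} (e , q) with em {k I.≤ i}
      ... | yes k≤i = begin
        to (j , a)                                              ≈⟨ below j≤i a ⟩
        (false , Hom.to (p j≤i) a)                              ≈⟨ Hom.cong (S.inclusion i) (p-comp _ k≤i j≤i a) ⟩
        (false , Hom.to (p k≤i) (Hom.to (p (I.reflexive e)) a)) ≈⟨ Hom.cong (S.inclusion i) (Hom.cong (p k≤i) q) ⟩
        (false , Hom.to (p k≤i) b)                              ∎
        where
        open SetoidReasoning (S.setoid i)
        j≤i = I.trans (I.reflexive e) k≤i
      ... | no k≰i = notBelow (λ j≤i → k≰i (I.trans (I.reflexive (I.Eq.sym e)) j≤i)) a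

      homo : ∀ {n} (f : τ n) (x : Vector A.Carrier n) →
             S._≈_ i (to (A.op f x)) (S.op i f (to ∘ x))
      homo {zero} c x = begin
        to (i₀ , Fib.op i₀ c _)                   ≈⟨ below i₀≤i _ ⟩
        (false , Hom.to (p i₀≤i) (Fib.op i₀ c _)) ≈⟨ Hom.cong (S.inclusion i) (Hom.homo (p i₀≤i) c _) ⟩
        (false , Fib.op i c _)                    ≈⟨ Hom.cong (S.inclusion i) (Fib.op-cong i c λ ()) ⟩
        S.op i c (to ∘ x)                         ∎
        where
        open SetoidReasoning (S.setoid i)
        i₀ = proj₁ (least c)
        i₀≤i = proj₂ (least c) i
      -- A join lies below `i` exactly when all the joined indices do, so the result goes to `∞`
      -- exactly when some argument does.
      homo {suc n} f x with em {⋁ index (proj₁ ∘ x) I.≤ i}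
      ... | yes j≤i = begin
        (false , Hom.to (p j≤i) (Fib.op j f x↑))       ≈⟨ Hom.cong (S.inclusion i) (Hom.homo (p j≤i) f x↑) ⟩
        (false , Fib.op i f (Hom.to (p j≤i) ∘ x↑))     ≈⟨ Hom.homo (S.inclusion i) f _ ⟩
        S.op i f (λ k → false , Hom.to (p j≤i) (x↑ k)) ≈⟨ S.op-cong i f agree ⟨
        S.op i f (to ∘ x)                              ∎
        where
        open SetoidReasoning (S.setoid i)
        j = ⋁ index (proj₁ ∘ x)

        x↑ : Vector (Fib.Carrier j) (suc n)
        x↑ k = Hom.to (p (≤-⋁ index (proj₁ ∘ x) k)) (proj₂ (x k))

        agree : ∀ k → S._≈_ i (to (x k)) (false , Hom.to (p j≤i) (x↑ k))
        agree k = begin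
          to (x k)                               ≈⟨ below k≤i (proj₂ (x k)) ⟩
          (false , Hom.to (p k≤i) (proj₂ (x k))) ≈⟨ Hom.cong (S.inclusion i) (p-comp _ j≤i k≤i _) ⟩
          (false , Hom.to (p j≤i) (x↑ k))        ∎
          where k≤i = I.trans (≤-⋁ index (proj₁ ∘ x) k) j≤i
      ... | no j≰i =
        let k , k≰i = ¬∀⟶∃¬ _ (λ k → proj₁ (x k) I.≤ i) (λ _ → em)
                        λ all → j≰i (⋁-least index (proj₁ ∘ x) all)
        in S.sym i {S.op i f (to ∘ x)} {S.∞ i} (S.∞-absorbs i f (to ∘ x)
             (k , S.sym i {to (x k)} {S.∞ i} (notBelow k≰i (proj₂ (x k)))))

    toFibre* : ∀ i → Hom 𝐀 (fibre i *)
    toFibre* i = record { to = to ; cong = λ {x} {y} → cong {x} {y} ; homo = homo }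
      where open ToStar i

    -- The map at `k` sends `(k , b)` to a finite element, hence also `(j , a)`, which forces
    -- `j ≤ k`; the map at `j` gives the converse. Then the finite values at `k` are compared.
    toFibre*-jointlyInjective : JointlyInjective (λ i → fibre i *) toFibre*
    toFibre*-jointlyInjective (j , a) (k , b) q =
      I.antisym j≤k k≤j , Fib.trans k (p-irrelevant 𝔸 _ j≤k a) (Fib.trans k pa≈pb (p-id _ b))
      where
      j≤k : j I.≤ k
      j≤k = decidable-stable em λ j≰k → ToStar.≈∞⇒notBelow k b (begin
        Hom.to (toFibre* k) (k , b) ≈⟨ q k ⟨
        Hom.to (toFibre* k) (j , a) ≈⟨ ToStar.notBelow k j≰k a ⟩
        S.∞ k                       ∎) I.refl
        where open SetoidReasoning (S.setoid k)

      k≤j : k I.≤ j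
      k≤j = decidable-stable em λ k≰j → ToStar.≈∞⇒notBelow j a (begin
        Hom.to (toFibre* j) (j , a) ≈⟨ q j ⟩
        Hom.to (toFibre* j) (k , b) ≈⟨ ToStar.notBelow j k≰j b ⟩
        S.∞ j                       ∎) I.refl
        where open SetoidReasoning (S.setoid j)

      pa≈pb : Fib._≈_ k (Hom.to (p j≤k) a) (Hom.to (p I.refl) b)
      pa≈pb = S.inclusion-injective k (begin
        (false , Hom.to (p j≤k) a)     ≈⟨ ToStar.below k j≤k a ⟨
        Hom.to (toFibre* k) (j , a)    ≈⟨ q k ⟩
        Hom.to (toFibre* k) (k , b)    ≈⟨ ToStar.below k I.refl b ⟩
        (false , Hom.to (p I.refl) b)  ∎)
        where open SetoidReasoning (S.setoid k)

    -- Every finite element is attained, so the question is whether `∞` is: this happens when some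
    -- index is not below `i`. Otherwise `i` is the greatest index, and the embedding collapses the
    -- semilattice to the single point `i`.
    embedded⇒≅fibre⊎≅fibre* : ∀ i → IsEmbedding (toFibre* i) → fibre i ≅ 𝐀 ⊎ 𝐀 ≅ fibre i *
    embedded⇒≅fibre⊎≅fibre* i emb with em {∃[ k ] ¬ k I.≤ i}
    ... | yes (k , k≰i) = inj₂ (toFibre* i , (λ {x} {y} → emb {x} {y}) , onto)
      where
      open SetoidReasoning (S.setoid i)

      onto : IsOnto (toFibre* i)
      onto (false , b) = (i , b) , λ {z} q → begin
        Hom.to (toFibre* i) z          ≈⟨ Hom.cong (toFibre* i) {z} {i , b} q ⟩
        Hom.to (toFibre* i) (i , b)    ≈⟨ ToStar.below i I.refl b ⟩
        (false , Hom.to (p I.refl) b)  ≈⟨ Hom.cong (S.inclusion i) (p-id _ b) ⟩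
        (false , b)                    ∎
      onto (true , _) = (k , c) , λ {z} q → begin
        Hom.to (toFibre* i) z          ≈⟨ Hom.cong (toFibre* i) {z} {k , c} q ⟩
        Hom.to (toFibre* i) (k , c)    ≈⟨ ToStar.notBelow i k≰i c ⟩
        S.∞ i                          ∎
        where c = Fib.nonEmpty k
    ... | no none = inj₁ (inclusion , inj , onto)
      where
      k≤i : ∀ k → k I.≤ i
      k≤i k = decidable-stable em λ k≰i → none (k , k≰i)

      -- Both elements have the same image in `fibre i *`. Their equality in the sum includes
      -- `i ≈ k`, which makes `i` the least index as well.
      shift : ∀ k (a : Fib.Carrier k) → (i , Hom.to (p (k≤i k)) a) A.≈ (k , a)
      shift k a = emb {i , Hom.to (p (k≤i k)) a} {k , a} (begin
        Hom.to (toFibre* i) (i , Hom.to (p (k≤i k)) a)       ≈⟨ ToStar.below i I.refl _ ⟩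
        (false , Hom.to (p I.refl) (Hom.to (p (k≤i k)) a))   ≈⟨ Hom.cong (S.inclusion i) (p-id _ _) ⟩
        (false , Hom.to (p (k≤i k)) a)                       ≈⟨ ToStar.below i (k≤i k) a ⟨
        Hom.to (toFibre* i) (k , a)                          ∎)
        where open SetoidReasoning (S.setoid i)

      minimum : Minimum I._≤_ i
      minimum k = I.reflexive (proj₁ (shift k (Fib.nonEmpty k)))

      inclusion = fibreInclusion 𝔸 i (λ _ → minimum)

      inj : IsEmbedding inclusion
      inj (e , q) = Fib.trans i (Fib.sym i (p-id _ _)) q

      onto : IsOnto inclusion
      onto (k , a) = Hom.to (p (k≤i k)) a , λ {z} q →
        A.trans {i , z} {i , Hom.to (p (k≤i k)) a} {k , a} (Hom.cong inclusion q) (shift k a)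

    irreducible⇒≅fibre⊎≅fibre* : Irreducible 𝐀 → ∃[ i ] (fibre i ≅ 𝐀 ⊎ 𝐀 ≅ fibre i *)
    irreducible⇒≅fibre⊎≅fibre* irr =
      let i , emb = irr (λ i → fibre i *) toFibre* toFibre*-jointlyInjective
      in i , embedded⇒≅fibre⊎≅fibre* i (λ {x} {y} → emb {x} {y})

-- Membership in the variety and the characterization.

trivial∈ᵥ : ∀ {v} (𝒱 : Variety τ ℓ v) {𝐀 𝐁 : Algebra τ ℓ} → Trivial 𝐀 → 𝐁 ∈ᵥ 𝒱 → 𝐀 ∈ᵥ 𝒱
-- A trivial algebra is the image of any algebra under a constant map.
trivial∈ᵥ 𝒱 {𝐀} {𝐁} t = Variety.closed-H 𝒱 {𝐁} {𝐀}
  (record { to = λ _ → Algebra.nonEmpty 𝐀 ; cong = λ _ → t _ _ ; homo = λ _ _ → t _ _ })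
  λ y → Algebra.nonEmpty 𝐁 , λ _ → t _ _

theorem6 : ∀ {ℓ v : Level} → ExcludedMiddle ℓ →
    (τ : Signature ℓ) → Plural τ →
    (𝒱 : Variety τ ℓ v) →
    (𝔸 : SemilatticeSystem τ ℓ ℓ) →
    (∀ i → SemilatticeSystem.fibre 𝔸 i ∈ᵥ 𝒱) →
    SubdirectlyIrreducible (PłonkaSum 𝔸)
    ⇔
    ( (PłonkaSum 𝔸 ∈ᵥ 𝒱 × SubdirectlyIrreducible (PłonkaSum 𝔸))
    ⊎ (∃[ 𝐁 ] (𝐁 ∈ᵥ 𝒱 × SubdirectlyIrreducible 𝐁 × ¬ HasAbsorbing 𝐁 × PłonkaSum 𝔸 ≅ 𝐁 *)) )
theorem6 {ℓ} {v} em τ _ 𝒱 𝔸 fibre∈𝒱 = mk⇔ to from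
  where
  open SemilatticeSystem 𝔸
  open Classical em

  Cases : Set _
  Cases = (PłonkaSum 𝔸 ∈ᵥ 𝒱 × SubdirectlyIrreducible (PłonkaSum 𝔸))
    ⊎ (∃[ 𝐁 ] (𝐁 ∈ᵥ 𝒱 × SubdirectlyIrreducible 𝐁 × ¬ HasAbsorbing 𝐁 × PłonkaSum 𝔸 ≅ 𝐁 *))

  to : SubdirectlyIrreducible (PłonkaSum 𝔸) → Cases
  to si with SI⇒trivial⊎irreducible si
  ... | inj₁ t = inj₁ (trivial∈ᵥ 𝒱 t (fibre∈𝒱 index-nonEmpty) , si)
  ... | inj₂ irr with irreducible⇒≅fibre⊎≅fibre* 𝔸 irr
  -- The sum is a homomorphic image of a fibre, hence lies in `𝒱`.
  ...   | i , inj₁ (h , _ , onto) = inj₁ (Variety.closed-H 𝒱 h onto (fibre∈𝒱 i) , si)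
  ...   | i , inj₂ iso = inj₂
    (fibre i , fibre∈𝒱 i , *-irreducible⇒SI (fibre i) irr* , *-no-absorbing (fibre i) irr* , iso)
    where irr* = irreducible-resp-≅ iso irr

  from : Cases → SubdirectlyIrreducible (PłonkaSum 𝔸)
  from (inj₁ (_ , si)) = si
  from (inj₂ (𝐁 , _ , si , no-absorbing , iso)) =
    irreducible⇒SI (irreducible-resp-≅ (≅-sym iso) (*-irreducible 𝐁 si no-absorbing))
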